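{- Let $m\ge 4$ and let $n$ be an integer with $2^{m-1}+1-2^{\lfloor m/2\rfloor}\le n\le 2^{m-1}-1$. Then $$g(n,m)=2n+\left\lfloor \frac{2^{m-1}-1-n}{2}\right\rfloor.$$
   Context: Write $[m]=\{1,\ldots,m\}$. For a multiset $\mathcal{F}=\{C_1,\ldots,C_t\}$ of non-empty subsets of $[m]$ (repetitions allowed; members indexed by $[t]$), a resolution into $n$ classes is a partition $\{A_1,\ldots,A_n\}$ of $[t]$ into $n$ blocks such that for each $i$ the sets $C_j$, $j\in A_i$, are pairwise disjoint with union $[m]$. $\mathcal{F}$ is uniquely resolvable with respect to $(n,m)$ if it has exactly one resolution into $n$ classes (partitions regarded as unordered). $g(n,m)$ is the maximum size of a uniquely resolvable multiset with respect to $(n,m)$. -}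

module Defs where

open import Data.Nat using (ℕ; _≤_)
open import Data.Fin using (Fin)
open import Data.Fin.Subset using (Subset; _∈_; Nonempty)
open import Data.Product using (Σ; ∃; _×_; _,_)
open import Relation.Binary.PropositionalEquality using (_≡_; _≢_)
open import Relation.Nullary using (¬_)
open import Function.Bundles using (_⇔_)

-- A multiset F = {C_1,...,C_t} of subsets of [m], indexed by Fin t.
-- Members must be non-empty.
AllNonempty : ∀ {m t} → (Fin t → Subset m) → Set
AllNonempty {t = t} C = (j : Fin t) → Nonempty (C j)

-- A partition {A_1,...,A_n} of [t] into n blocks, given by a labelling
-- c : Fin t → Fin n with A_i = c⁻¹(i); blocks are non-empty (c surjective).
-- Each class A_i consists of pairwise disjoint sets with union [m].
IsResolution : ∀ {m t} (n : ℕ) → (Fin t → Subset m) → (Fin t → Fin n) → Set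
IsResolution {m} {t} n C c =
    ((i : Fin n) → ∃ λ (j : Fin t) → c j ≡ i)
  × ((i : Fin n) → (j k : Fin t) → c j ≡ i → c k ≡ i → j ≢ k →
       (x : Fin m) → ¬ (x ∈ C j × x ∈ C k))
  × ((i : Fin n) → (x : Fin m) → ∃ λ (j : Fin t) → c j ≡ i × x ∈ C j)

SamePartition : ∀ {t n} → (Fin t → Fin n) → (Fin t → Fin n) → Set
SamePartition {t} c c' = (j k : Fin t) → (c j ≡ c k) ⇔ (c' j ≡ c' k)

UniquelyResolvable : ∀ {m t} (n : ℕ) → (Fin t → Subset m) → Set
UniquelyResolvable {m} {t} n C =
  AllNonempty C
  × (∃ λ (c : Fin t → Fin n) → IsResolution n C c)
  × ((c c' : Fin t → Fin n) → IsResolution n C c → IsResolution n C c' →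
       SamePartition c c')

IsMaxURSize : ℕ → ℕ → ℕ → Set
IsMaxURSize n m v =
  (Σ (Fin v → Subset m) λ C → UniquelyResolvable n C)
  × ((t : ℕ) (C : Fin t → Subset m) → UniquelyResolvable n C → t ≤ v)

{-# OPTIONS --safe #-}
module Submission where

-- Upper bound.  If unions of members of two different classes of the unique
-- resolution agree, those members can be exchanged, so such a union is empty
-- or everything.  A class with k members, k - 1 of which miss the point 0,
-- contributes those members and the unions of their initial segments: 2k - 3
-- distinct non-empty sets missing 0 (for k ≥ 2), and none of these occurs for
-- another class.  Hence 2t - 3n ≤ 2^(m-1) - 1.
--
-- Lower bound.  Take r = ⌊(2^(m-1) - 1 - n)/2⌋ classes of three sets and n - r
-- complementary pairs, all inducing different bipartitions.  A set of a triple
-- has no complement in the family; weighing sets of pairs 3 and sets of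
-- triples 2, every class of any resolution weighs at least 6, while the total
-- is 6n.  So each class is a pair or consists of three sets from triples.
-- The triples are indexed by 0/1-words of length ⌊m/2⌋ - 1 other than 1…1, one
-- two-point block per letter b, of which the three sets take (b,0), (1-b,b)
-- and (0,1-b): letters that are not all equal never partition a block.

open import Defs
open import Data.Bool as Bool using (Bool; true; false; not; if_then_else_)
open import Data.Bool.Properties using (¬-not; not-involutive)
open import Data.Empty using (⊥; ⊥-elim)
open import Data.Fin as Fin using (Fin; zero; suc; inject₁; fromℕ)
open import Data.Fin.Patterns using (0F; 1F; 2F)
open import Data.Fin.Permutation.Components using (transpose)
open import Data.Fin.Properties using (_≟_; _≤?_; _<?_; any?; all?; <-cmp; ≤-antisym; injective⇒≤; +↔⊎; *↔×; 2↔Bool; 1↔⊤; inject₁-injective; fromℕ≢inject₁)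
open import Data.Fin.Subset using (Subset)
open import Data.Nat using (ℕ; zero; suc; _+_; _*_; _∸_; _^_; _≤_; _<_; _/_; s≤s)
import Data.Nat.Properties as ℕ
open import Data.Nat.DivMod using (_%_; m≡m%n+[m/n]*n; m%n<n; /-monoˡ-≤)
open import Data.Nat.Solver using (module +-*-Solver)
open import Data.Product using (Σ; ∃; _×_; _,_; proj₁; proj₂)
open import Data.Product.Function.NonDependent.Propositional using (_×-↔_)
import Data.Product.Properties as Product
open import Data.Product.Properties using (,-injectiveˡ; ,-injectiveʳ)
open import Data.Sum using (_⊎_; inj₁; inj₂; [_,_]′)
open import Data.Sum.Function.Propositional using (_⊎-↔_)
import Data.Sum.Properties as Sum
open import Data.Sum.Properties using (inj₁-injective; inj₂-injective)
open import Data.Unit using (⊤; tt)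
open import Data.Vec using (Vec; []; _∷_; lookup; tabulate; replicate; map; head; tail)
open import Data.Vec.Properties using (lookup∘tabulate; tabulate∘lookup; tabulate-cong; lookup-map; lookup-replicate; []=⇒lookup; lookup⇒[]=)
open import Function using (_∘_; id)
open import Function.Bundles using (_↔_; mk⇔; mk↔ₛ′; Inverse; Injection; Equivalence)
open import Function.Definitions using (Injective)
open import Function.Properties.Inverse using (↔-refl; ↔-trans; ↔-sym; ↔⇒↣)
open import Relation.Binary.Definitions using (DecidableEquality; tri<; tri≈; tri>)
open import Relation.Binary.PropositionalEquality
open import Relation.Nullary using (¬_; Dec; yes; no; does; contradiction)
open import Relation.Nullary.Decidable using (dec-true; dec-false; _×-dec_; ¬?)

open +-*-Solver using (solve; _:+_; _:*_; _:=_; con)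

private variable
  A B I K : Set
  a b m n t : ℕ

-- Counting

to-injective : (e : A ↔ B) → Injective _≡_ _≡_ (Inverse.to e)
to-injective e = Injection.injective (↔⇒↣ e)

from-injective : (e : A ↔ B) → Injective _≡_ _≡_ (Inverse.from e)
from-injective e = to-injective (↔-sym e)

↔-injective⇒≤ : Fin a ↔ A → Fin b ↔ B → (f : A → B) → Injective _≡_ _≡_ f → a ≤ b
↔-injective⇒≤ e e′ f inj = injective⇒≤ {f = Inverse.from e′ ∘ f ∘ Inverse.to e}
  (to-injective e ∘ inj ∘ from-injective e′)

-- A missed value `y`, put in front of `f`, would inject `Fin (suc a)` into `Fin a`.
injective⇒surjective : (f : Fin a → Fin a) → Injective _≡_ _≡_ f → ∀ y → ∃ λ x → f x ≡ y
injective⇒surjective {a} f inj y with any? (λ x → f x ≟ y)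
... | yes hit = hit
... | no miss = contradiction (injective⇒≤ {f = g} g-injective) ℕ.1+n≰n
  where
  g : Fin (suc a) → Fin a
  g zero    = y
  g (suc x) = f x
  g-injective : Injective _≡_ _≡_ g
  g-injective {zero}  {zero}  _  = refl
  g-injective {zero}  {suc z} eq = contradiction (z , sym eq) miss
  g-injective {suc x} {zero}  eq = contradiction (x , eq) miss
  g-injective {suc x} {suc z} eq = cong suc (inj eq)

↔-injective⇒surjective : Fin a ↔ A → Fin a ↔ B → (f : A → B) → Injective _≡_ _≡_ f →
                         ∀ y → ∃ λ x → f x ≡ y
↔-injective⇒surjective e e′ f inj y
  with x , eq ← injective⇒surjective (Inverse.from e′ ∘ f ∘ Inverse.to e)
                  (to-injective e ∘ inj ∘ from-injective e′) (Inverse.from e′ y)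
  = Inverse.to e x , from-injective e′ eq

<⇒∃-missed : a < b → (f : Fin a → Fin b) → ∃ λ y → ∀ x → f x ≢ y
<⇒∃-missed {a} {b} a<b f with any? (λ y → all? (λ x → ¬? (f x ≟ y)))
... | yes missed = missed
... | no ¬missed = contradiction (injective⇒≤ {f = pre} pre-injective) (ℕ.<⇒≱ a<b)
  where
  hit : ∀ y → ∃ λ x → f x ≡ y
  hit y with any? (λ x → f x ≟ y)
  ... | yes p = p
  ... | no ¬p = contradiction (y , λ x eq → ¬p (x , eq)) ¬missed
  pre : Fin b → Fin a
  pre = proj₁ ∘ hit
  pre-injective : Injective _≡_ _≡_ pre
  pre-injective {y} {z} eq = trans (sym (proj₂ (hit y))) (trans (cong f eq) (proj₂ (hit z)))

-- Greedy choice: each chosen value joins the forbidden list `f`. Only the length of that list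
-- enters the bound, so it may repeat values.
avoiding-injection : ∀ s → a + s ≤ b → (f : Fin a → Fin b) →
  Σ (Fin s → Fin b) λ g → Injective _≡_ _≡_ g × (∀ x y → f x ≢ g y)
avoiding-injection zero    _     f = (λ ()) , (λ { {()} }) , λ _ ()
avoiding-injection {a} {b} (suc s) a+s<b f
  with y , missed ← <⇒∃-missed (ℕ.≤-trans (s≤s (ℕ.m≤m+n a s)) (subst (_≤ b) (ℕ.+-suc a s) a+s<b)) f
  with g , g-injective , avoids ← avoiding-injection s (subst (_≤ b) (ℕ.+-suc a s) a+s<b)
                                    (λ { zero → y ; (suc x) → f x })
  = g′ , g′-injective , λ { x zero → missed x ; x (suc z) → avoids (suc x) z }
  where
  g′ : Fin (suc s) → Fin b
  g′ zero    = y
  g′ (suc x) = g x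
  g′-injective : Injective _≡_ _≡_ g′
  g′-injective {zero}  {zero}  _  = refl
  g′-injective {zero}  {suc z} eq = contradiction eq (avoids zero z)
  g′-injective {suc x} {zero}  eq = contradiction (sym eq) (avoids zero x)
  g′-injective {suc x} {suc z} eq = cong suc (g-injective eq)

∷↔ : (A × Vec A n) ↔ Vec A (suc n)
∷↔ = mk↔ₛ′ (λ (x , v) → x ∷ v) (λ v → head v , tail v) (λ { (_ ∷ _) → refl }) (λ _ → refl)

bits : ∀ k → Fin (2 ^ k) ↔ Vec Bool k
bits zero    = mk↔ₛ′ (λ _ → []) (λ _ → zero) (λ { [] → refl }) (λ { zero → refl })
bits (suc k) = ↔-trans *↔× (↔-trans (2↔Bool ×-↔ bits k) ∷↔)

-- Resolutions and the exchange of members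

-- A resolution presented by the function sending a class i and a point x to
-- the member of class i that contains x.
record Resolution {m} (F : I → Subset m) (K : Set) : Set where
  field
    class        : I → K
    member       : K → Fin m → I
    class-member : ∀ i x → class (member i x) ≡ i
    covers       : ∀ i x → lookup (F (member i x)) x ≡ true
    unique       : ∀ j x → lookup (F j) x ≡ true → member (class j) x ≡ j

  member⇒∈ : ∀ {i x j} → member i x ≡ j → lookup (F j) x ≡ true
  member⇒∈ {i} {x} refl = covers i x

open Resolution

fromIsResolution : {F : Fin t → Subset m} {c : Fin t → Fin n} → IsResolution n F c →
                   Σ (Resolution F (Fin n)) λ R → class R ≡ c
fromIsResolution {F = F} {c} (_ , disjoint , cover) = record
  { class        = c
  ; member       = λ i x → proj₁ (cover i x)
  ; class-member = λ i x → proj₁ (proj₂ (cover i x))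
  ; covers       = λ i x → []=⇒lookup (proj₂ (proj₂ (cover i x)))
  ; unique       = uniq
  } , refl
  where
  uniq : ∀ j x → lookup (F j) x ≡ true → proj₁ (cover (c j) x) ≡ j
  uniq j x x∈j with k , ck , x∈k ← cover (c j) x with k ≟ j
  ... | yes eq = eq
  ... | no neq = contradiction (x∈k , lookup⇒[]= x (F j) x∈j) (disjoint (c j) k j ck refl neq x)

toIsResolution : {F : Fin t → Subset (suc m)} (R : Resolution F (Fin n)) → IsResolution n F (class R)
toIsResolution {F = F} R =
    (λ i → member R i zero , class-member R i zero)
  , (λ { i j k cj ck j≢k x (x∈j , x∈k) → j≢k (trans
        (sym (unique R j x ([]=⇒lookup x∈j)))
        (trans (cong (λ z → member R z x) (trans cj (sym ck))) (unique R k x ([]=⇒lookup x∈k)))) })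
  , (λ i x → member R i x , class-member R i x , lookup⇒[]= x _ (covers R i x))

-- Members satisfying `Q` move from class `i` to class `τ i`. By `Q-τ` those of `i` and those of
-- `τ i` have the same union, so every new class is again a partition.
module Exchange {F : I → Subset m} (R : Resolution F K) (τ : K → K) (ττ : ∀ i → τ (τ i) ≡ i)
                (Q : I → Bool) (Q-τ : ∀ i x → Q (member R (τ i) x) ≡ Q (member R i x)) where

  move : Bool → K → K
  move q i = if q then τ i else i

  move-move : ∀ q i → move q (move q i) ≡ i
  move-move false i = refl
  move-move true  i = ττ i

  Q-move : ∀ q i x → Q (member R (move q i) x) ≡ Q (member R i x)
  Q-move false i x = refl
  Q-move true  i x = Q-τ i x

  exchange : Resolution F K
  exchange .class j         = move (Q j) (class R j)
  exchange .member i x      = member R (move (Q (member R i x)) i) x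
  exchange .class-member i x = trans
    (cong₂ move (Q-move (Q (member R i x)) i x) (class-member R _ x)) (move-move (Q (member R i x)) i)
  exchange .covers i x      = covers R _ x
  exchange .unique j x x∈j  = trans (cong (λ q → member R (move q (move (Q j) (class R j))) x)
      (trans (Q-move (Q j) (class R j) x) (cong Q (unique R j x x∈j))))
    (trans (cong (λ i → member R i x) (move-move (Q j) (class R j))) (unique R j x x∈j))

transpose-ˡ : ∀ (i i′ : Fin n) → transpose i i′ i ≡ i′
transpose-ˡ i i′ rewrite dec-true (i ≟ i) refl = refl

transpose-ʳ : ∀ (i i′ : Fin n) → transpose i i′ i′ ≡ i
transpose-ʳ i i′ with i′ ≟ i
... | yes i′≡i = i′≡i
... | no _ rewrite dec-true (i′ ≟ i′) refl = refl

transpose-≢ : ∀ {i i′ k : Fin n} → k ≢ i → k ≢ i′ → transpose i i′ k ≡ k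
transpose-≢ {i = i} {i′} {k} k≢i k≢i′ rewrite dec-false (k ≟ i) k≢i | dec-false (k ≟ i′) k≢i′ = refl

transpose-elim : ∀ (P : Fin n → Fin n → Set) i i′ → P i i′ → P i′ i →
                 (∀ k → k ≢ i → k ≢ i′ → P k k) → ∀ k → P k (transpose i i′ k)
transpose-elim P i i′ p p′ r k with k ≟ i
... | yes refl = p
... | no k≢i with k ≟ i′
...   | yes refl = p′
...   | no k≢i′  = r k k≢i k≢i′

transpose-involutive : ∀ (i i′ k : Fin n) → transpose i i′ (transpose i i′ k) ≡ k
transpose-involutive i i′ = transpose-elim (λ k v → transpose i i′ v ≡ k) i i′
  (transpose-ʳ i i′) (transpose-ˡ i i′) (λ _ → transpose-≢)

does-true⇒ : (A? : Dec A) → does A? ≡ true → A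
does-true⇒ (yes p) _ = p

-- Upper bound

module UpperBound {m n t : ℕ} {F : Fin t → Subset (suc m)} (R : Resolution F (Fin n))
                  (nonempty : AllNonempty F)
                  (coincide : ∀ c → IsResolution n F c → SamePartition (class R) c) where

  -- By `agree` the `P`-members of class `i` and the `P′`-members of class `i′` have the same union,
  -- which contains `x` but not `y`. Exchanging them separates two members of class `i`, against
  -- uniqueness.
  classes-separated : ∀ {i i′} → i ≢ i′ → (P P′ : Fin t → Bool) →
    (∀ x → P (member R i x) ≡ P′ (member R i′ x)) →
    ∀ x y → P (member R i x) ≡ true → P (member R i y) ≡ false → ⊥
  classes-separated {i} {i′} i≢i′ P P′ agree x y Px Py =
    i≢i′ (trans (sym (trans (cong (λ q → move q (class R (member R i y))) (trans (Q-i y) Py)) (class-member R i y)))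
         (trans (sym same)
         (trans (cong (λ q → move q (class R (member R i x))) (trans (Q-i x) Px))
                (trans (cong (transpose i i′) (class-member R i x)) (transpose-ˡ i i′)))))
    where
    Q : Fin t → Bool
    -- `P′` also serves as the default on the other classes, which the transposition fixes.
    Q j = if does (class R j ≟ i) then P j else P′ j
    Q-i : ∀ z → Q (member R i z) ≡ P (member R i z)
    Q-i z rewrite dec-true (class R (member R i z) ≟ i) (class-member R i z) = refl
    Q-i′ : ∀ z → Q (member R i′ z) ≡ P′ (member R i′ z)
    Q-i′ z rewrite dec-false (class R (member R i′ z) ≟ i)
                     (λ eq → i≢i′ (trans (sym eq) (class-member R i′ z))) = refl
    swapped : ∀ z → Q (member R i z) ≡ Q (member R i′ z)
    swapped z = trans (Q-i z) (trans (agree z) (sym (Q-i′ z)))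
    open Exchange R (transpose i i′)
      (transpose-involutive i i′)
      Q (λ k z → transpose-elim (λ k k′ → Q (member R k′ z) ≡ Q (member R k z)) i i′
                   (sym (swapped z)) (swapped z) (λ _ _ _ → refl) k)
    same : class exchange (member R i x) ≡ class exchange (member R i y)
    same = Equivalence.to (coincide (class exchange) (toIsResolution exchange) (member R i x) (member R i y))
             (trans (class-member R i x) (sym (class-member R i y)))

  root : Fin n → Fin t
  root i = member R i zero

  point : ∀ j → ∃ λ x → member R (class R j) x ≡ j
  point j with x , x∈j ← nonempty j = x , unique R j x ([]=⇒lookup x∈j)

  -- The members of a class that miss the point 0 are ordered by index. For such a `j` the union up
  -- to `j` is more than `j` alone exactly when a smaller one exists.
  NonFirst : Fin t → Set
  NonFirst j = ∃ λ x → member R (class R j) x Fin.< j × member R (class R j) x ≢ root (class R j)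

  nonFirst? : ∀ j → Dec (NonFirst j)
  nonFirst? j = any? λ x → (_ <? j) ×-dec ¬? (_ ≟ _)

  equalTo upTo : Fin t → Fin t → Bool
  equalTo j e = does (e ≟ j)
  upTo j e    = does ((e ≤? j) ×-dec ¬? (e ≟ root (class R e)))

  union : Fin n → (Fin t → Bool) → Subset m
  union i P = tabulate λ x → P (member R i (suc x))

  -- The member C_j and the union of the members of its class up to C_j, both
  -- left out when C_j contains the point 0, the union also when it is C_j.
  data Code (j : Fin t) : Fin 2 → Subset m ⊎ (Fin n × Fin 3) → Set where
    isRoot  : j ≡ root (class R j) → ∀ b → Code j b (inj₂ (class R j , inject₁ b))
    isFirst : j ≢ root (class R j) → ¬ NonFirst j → Code j (suc zero) (inj₂ (class R j , fromℕ 2))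
    single  : j ≢ root (class R j) → Code j zero (inj₁ (union (class R j) (equalTo j)))
    prefix  : j ≢ root (class R j) → NonFirst j → Code j (suc zero) (inj₁ (union (class R j) (upTo j)))

  code : ∀ j b → ∃ (Code j b)
  code j b with j ≟ root (class R j)
  code j b          | yes eq = _ , isRoot eq b
  code j zero       | no neq = _ , single neq
  code j (suc zero) | no neq with nonFirst? j
  ... | yes nf = _ , prefix neq nf
  ... | no ¬nf = _ , isFirst neq ¬nf

  equalTo-root : ∀ {j} → j ≢ root (class R j) → equalTo j (root (class R j)) ≡ false
  equalTo-root neq = dec-false (_ ≟ _) (neq ∘ sym)

  equalTo-self : ∀ j → equalTo j j ≡ true
  equalTo-self j = dec-true (j ≟ j) refl

  equalTo⇒≡ : ∀ {j e} → equalTo j e ≡ true → e ≡ j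
  equalTo⇒≡ = does-true⇒ (_ ≟ _)

  upTo-root : ∀ j i → upTo j (root i) ≡ false
  upTo-root j i = dec-false ((root i ≤? j) ×-dec ¬? (root i ≟ root (class R (root i))))
    λ (_ , neq) → neq (cong root (sym (class-member R i zero)))

  ≤⇒upTo : ∀ {j e} → e Fin.≤ j → e ≢ root (class R e) → upTo j e ≡ true
  ≤⇒upTo e≤j neq = dec-true ((_ ≤? _) ×-dec ¬? (_ ≟ _)) (e≤j , neq)

  upTo⇒≤ : ∀ {j e} → upTo j e ≡ true → e Fin.≤ j
  upTo⇒≤ {j} {e} eq = proj₁ (does-true⇒ ((e ≤? j) ×-dec ¬? (e ≟ root (class R e))) eq)

  union-≡ : ∀ {i i′ P P′} → P (root i) ≡ false → P′ (root i′) ≡ false →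
            union i P ≡ union i′ P′ → ∀ x → P (member R i x) ≡ P′ (member R i′ x)
  union-≡ r r′ eq zero    = trans r (sym r′)
  union-≡ r r′ eq (suc x) = trans (sym (lookup∘tabulate _ x))
    (trans (cong (λ v → lookup v x) eq) (lookup∘tabulate _ x))

  -- A union that contains `j` but not the root is neither empty nor full, so `classes-separated`
  -- excludes it from any other class.
  same-class : ∀ {j j′ P P′} → P (root (class R j)) ≡ false → P′ (root (class R j′)) ≡ false → P j ≡ true →
               union (class R j) P ≡ union (class R j′) P′ →
               class R j ≡ class R j′
  same-class {j} {j′} {P} {P′} r r′ Pj eq with class R j ≟ class R j′
  ... | yes same = same
  ... | no  neq  = ⊥-elim (classes-separated neq P P′ (union-≡ {P = P} {P′} r r′ eq) (proj₁ (point j)) zero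
                     (trans (cong P (proj₂ (point j))) Pj) r)

  -- Every member `e` has a point, and there the common union shows both whether `P e` and whether
  -- `P′ e` holds.
  agree-on-class : ∀ {j j′ P P′} → P (root (class R j)) ≡ false → P′ (root (class R j′)) ≡ false → P j ≡ true →
    union (class R j) P ≡ union (class R j′) P′ → ∀ e → class R e ≡ class R j → P e ≡ P′ e
  agree-on-class {j} {j′} {P} {P′} r r′ Pj eq e ce with x , xe ← point e =
    trans (cong P (sym xj)) (trans (union-≡ {P = P} {P′} r r′ eq x) (cong P′ xj′))
    where
    xj : member R (class R j) x ≡ e
    xj = trans (cong (λ i → member R i x) (sym ce)) xe
    xj′ : member R (class R j′) x ≡ e
    xj′ = trans (cong (λ i → member R i x) (sym (same-class {P = P} {P′} r r′ Pj eq))) xj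

  union≢∅ : ∀ {j P} → P (root (class R j)) ≡ false → P j ≡ true →
            union (class R j) P ≢ replicate m false
  union≢∅ {j} {P} r Pj eq with point j
  ... | zero  , xj = contradiction (trans (sym (trans (cong P xj) Pj)) r) λ ()
  ... | suc x , xj = contradiction (trans (sym (trans (lookup∘tabulate _ x) (trans (cong P xj) Pj)))
                       (trans (cong (λ v → lookup v x) eq) (lookup-replicate x false))) λ ()

  -- The union up to `j′` contains `j′` and, by `NonFirst`, a smaller member; equality would make
  -- both of them `j`.
  single≢prefix : ∀ {j j′} → j ≢ root (class R j) → j′ ≢ root (class R j′) → NonFirst j′ →
                  union (class R j) (equalTo j) ≢ union (class R j′) (upTo j′)
  single≢prefix {j} {j′} nr nr′ (x , e<j′ , e≢root) eq = ℕ.<-irrefl (cong Fin.toℕ (trans e≡j (sym j′≡j))) e<j′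
    where
    e = member R (class R j′) x
    ce : class R e ≡ class R j′
    ce = class-member R _ x
    agree : ∀ e → class R e ≡ class R j′ → upTo j′ e ≡ equalTo j e
    agree = agree-on-class {j′} {j} {upTo j′} {equalTo j}
      (upTo-root _ _) (equalTo-root nr) (≤⇒upTo {j′} {j′} ℕ.≤-refl nr′) (sym eq)
    j′≡j : j′ ≡ j
    j′≡j = equalTo⇒≡ (trans (sym (agree j′ refl)) (≤⇒upTo ℕ.≤-refl nr′))
    e≡j : e ≡ j
    e≡j = equalTo⇒≡ (trans (sym (agree e ce)) (≤⇒upTo (ℕ.<⇒≤ e<j′)
            (λ p → e≢root (trans p (cong root ce)))))

  -- Otherwise `j` itself witnesses `NonFirst j′`.
  first-unique : ∀ {j j′} → j ≢ root (class R j) → class R j ≡ class R j′ → ¬ NonFirst j′ → ¬ j Fin.< j′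
  first-unique {j} {j′} nr same first j<j′ with x , xj ← point j =
    first (x , subst (Fin._< j′) (sym xj′) j<j′ , λ p → nr (trans (sym xj′) (trans p (cong root (sym same)))))
    where
    xj′ : member R (class R j′) x ≡ j
    xj′ = trans (cong (λ i → member R i x) (sym same)) xj

  Code-injective : ∀ {j j′ b b′ v v′} → Code j b v → Code j′ b′ v′ → v ≡ v′ → j ≡ j′ × b ≡ b′
  Code-injective (isRoot r b) (isRoot r′ b′) eq =
    trans r (trans (cong root (,-injectiveˡ (inj₂-injective eq))) (sym r′)) ,
    inject₁-injective (,-injectiveʳ (inj₂-injective eq))
  Code-injective (isRoot _ b) (isFirst _ _) eq =
    contradiction (sym (,-injectiveʳ (inj₂-injective eq))) fromℕ≢inject₁
  Code-injective (isFirst _ _) (isRoot _ b) eq =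
    contradiction (,-injectiveʳ (inj₂-injective eq)) fromℕ≢inject₁
  Code-injective {j} {j′} (isFirst nr f) (isFirst nr′ f′) eq with <-cmp j j′
  ... | tri≈ _ p _ = p , refl
  ... | tri< p _ _ = contradiction p (first-unique nr (,-injectiveˡ (inj₂-injective eq)) f′)
  ... | tri> _ _ p = contradiction p (first-unique nr′ (sym (,-injectiveˡ (inj₂-injective eq))) f)
  Code-injective {j} {j′} (single nr) (single nr′) eq =
    equalTo⇒≡ (trans (sym (agree-on-class {P = equalTo j} {equalTo j′} (equalTo-root nr) (equalTo-root nr′)
      (equalTo-self j) (inj₁-injective eq) j refl)) (equalTo-self j)) , refl
  Code-injective (single nr) (prefix nr′ nf) eq = contradiction (inj₁-injective eq) (single≢prefix nr nr′ nf)
  Code-injective (prefix nr′ nf) (single nr) eq = contradiction (sym (inj₁-injective eq)) (single≢prefix nr nr′ nf)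
  Code-injective {j} {j′} (prefix nr nf) (prefix nr′ nf′) eq =
    -- Each of two equal initial unions contains the last member of the other, which bounds the
    -- indices both ways.
    ≤-antisym (half nr nr′ (inj₁-injective eq)) (half nr′ nr (sym (inj₁-injective eq))) , refl
    where
    half : ∀ {j j′} → j ≢ root (class R j) → j′ ≢ root (class R j′) →
           union (class R j) (upTo j) ≡ union (class R j′) (upTo j′) → j Fin.≤ j′
    half {j} {j′} nr nr′ eq = upTo⇒≤ (trans (sym (agree-on-class {P = upTo j} {upTo j′}
      (upTo-root j _) (upTo-root j′ _) (≤⇒upTo {j} {j} ℕ.≤-refl nr) eq j refl)) (≤⇒upTo {j} {j} ℕ.≤-refl nr))

  Code≢∅ : ∀ {j b v} → Code j b v → v ≢ inj₁ (replicate m false)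
  Code≢∅ {j} (single nr) eq = union≢∅ {P = equalTo j} (equalTo-root nr) (equalTo-self j) (inj₁-injective eq)
  Code≢∅ {j} (prefix nr _) eq =
    union≢∅ {P = upTo j} (upTo-root j _) (≤⇒upTo {j} {j} ℕ.≤-refl nr) (inj₁-injective eq)

  -- The summand `⊤` accounts for the empty set. Each class reserves three labels for the codes left
  -- out: two for its root, one for the union up to its first other member.
  encode : ⊤ ⊎ (Fin t × Fin 2) → Subset m ⊎ (Fin n × Fin 3)
  encode (inj₁ _)       = inj₁ (replicate m false)
  encode (inj₂ (j , b)) = proj₁ (code j b)

  encode-injective : Injective _≡_ _≡_ encode
  encode-injective {inj₁ _} {inj₁ _} _ = refl
  encode-injective {inj₁ _} {inj₂ (j , b)} eq = contradiction (sym eq) (Code≢∅ (proj₂ (code j b)))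
  encode-injective {inj₂ (j , b)} {inj₁ _} eq = contradiction eq (Code≢∅ (proj₂ (code j b)))
  encode-injective {inj₂ (j , b)} {inj₂ (j′ , b′)} eq
    with refl , refl ← Code-injective (proj₂ (code j b)) (proj₂ (code j′ b′)) eq = refl

  bound : 1 + t * 2 ≤ 2 ^ m + n * 3
  bound = ↔-injective⇒≤ (↔-trans +↔⊎ (1↔⊤ ⊎-↔ *↔×)) (↔-trans +↔⊎ (bits m ⊎-↔ *↔×))
            encode encode-injective

-- Uniquely resolvable families over arbitrary index types

reindex : ∀ {I J K L : Set} {F : I → Subset m} (e : J ↔ I) (f : K ↔ L) →
          Resolution F K → Resolution (F ∘ Inverse.to e) L
reindex {F = F} e f R = record
  { class        = λ j → Inverse.to f (class R (Inverse.to e j))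
  ; member       = λ i x → Inverse.from e (member R (Inverse.from f i) x)
  ; class-member = λ i x → trans (cong (Inverse.to f) (trans (cong (class R) (Inverse.strictlyInverseˡ e _))
                                                             (class-member R _ x)))
                                 (Inverse.strictlyInverseˡ f i)
  ; covers       = λ i x → trans (cong (λ j → lookup (F j) x) (Inverse.strictlyInverseˡ e _)) (covers R _ x)
  ; unique       = λ j x x∈j → trans (cong (Inverse.from e) (trans
                     (cong (λ i → member R i x) (Inverse.strictlyInverseʳ f _)) (unique R _ x x∈j)))
                     (Inverse.strictlyInverseʳ e j)
  }

-- Not `reindex` along the inverse bijection: that would resolve `F ∘ to e ∘ from e`, which agrees
-- with `F` only pointwise.
unindex : ∀ {I J K L : Set} {F : I → Subset m} (e : J ↔ I) (f : K ↔ L) →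
          Resolution (F ∘ Inverse.to e) L → Resolution F K
unindex {F = F} e f R = record
  { class        = λ j → Inverse.from f (class R (Inverse.from e j))
  ; member       = λ i x → Inverse.to e (member R (Inverse.to f i) x)
  ; class-member = λ i x → trans (cong (Inverse.from f) (trans (cong (class R) (Inverse.strictlyInverseʳ e _))
                                                               (class-member R _ x)))
                                 (Inverse.strictlyInverseʳ f i)
  ; covers       = λ i x → covers R _ x
  ; unique       = λ j x x∈j → trans (cong (Inverse.to e) (trans
                     (cong (λ i → member R i x) (Inverse.strictlyInverseˡ f _))
                     (unique R _ x (trans (cong (λ j → lookup (F j) x) (Inverse.strictlyInverseˡ e j)) x∈j))))
                     (Inverse.strictlyInverseˡ e j)
  }

_Refines_ : {F : I → Subset m} → Resolution F K → Resolution F K → Set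
R Refines R′ = ∀ j k → class R j ≡ class R k → class R′ j ≡ class R′ k

-- A class of `R` already covers everything. At a point of `k` the `R`-class of `j` has a member
-- `l`, which lies in the same `R′`-class as `k` and meets it, so `l` is `k`.
refines⇒coarsens : {F : I → Subset m} (R R′ : Resolution F K) → (∀ j → ∃ λ x → lookup (F j) x ≡ true) →
                   R Refines R′ → R′ Refines R
refines⇒coarsens {F = F} R R′ nonempty ref j k eq with x , x∈k ← nonempty k =
  trans (sym (class-member R (class R j) x)) (cong (class R) l≡k)
  where
  l = member R (class R j) x
  l≡k : l ≡ k
  l≡k = trans (sym (unique R′ l x (covers R _ x)))
    (trans (cong (λ i → member R′ i x) (trans (ref l j (class-member R _ x)) eq)) (unique R′ k x x∈k))

-- One resolution finer than all others suffices: by `refines⇒coarsens` every resolution then gives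
-- the same partition.
uniquelyResolvable : ∀ {I K : Set} {F : I → Subset (suc m)} (e : Fin t ↔ I) (f : Fin n ↔ K) (R : Resolution F K) →
  (∀ j → ∃ λ x → lookup (F j) x ≡ true) → (∀ R′ → R Refines R′) → UniquelyResolvable n (F ∘ Inverse.to e)
uniquelyResolvable {n = n} {K = K} {F = F} e f R nonempty ref =
    (λ j → let x , x∈j = nonempty (Inverse.to e j) in x , lookup⇒[]= x _ x∈j)
  , (_ , toIsResolution (reindex {F = F} e (↔-sym f) R))
  , λ c c′ r r′ j k → mk⇔ (transfer c c′ r r′ j k) (transfer c′ c r′ r j k)
  where
  toᴵ = Inverse.to e
  back : Resolution (F ∘ toᴵ) (Fin n) → Resolution F K
  back = unindex {F = F} e (↔-sym f)
  class-back : ∀ S j → Inverse.from f (class (back S) (toᴵ j)) ≡ class S j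
  class-back S j = trans (Inverse.strictlyInverseʳ f (class S (Inverse.from e (toᴵ j))))
                         (cong (class S) (Inverse.strictlyInverseʳ e j))
  transfer : ∀ c c′ → IsResolution n (F ∘ toᴵ) c → IsResolution n (F ∘ toᴵ) c′ →
             ∀ j k → c j ≡ c k → c′ j ≡ c′ k
  transfer c c′ r r′ j k eq with S , refl ← fromIsResolution r with S′ , refl ← fromIsResolution r′ =
    trans (sym (class-back S′ j)) (trans (cong (Inverse.from f) coarse) (class-back S′ k))
    where
    coarse : class (back S′) (toᴵ j) ≡ class (back S′) (toᴵ k)
    coarse = ref (back S′) (toᴵ j) (toᴵ k) (refines⇒coarsens R (back S) nonempty (ref (back S)) (toᴵ j) (toᴵ k)
               (from-injective f (trans (class-back S j) (trans eq (sym (class-back S k))))))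

-- Rigid triples

ExactlyOne : {A : Set} → (A → Bool) → Set
ExactlyOne b = ∃ λ h → b h ≡ true × ∀ h′ → b h′ ≡ true → h′ ≡ h

tri : {A : Set} → A → A → A → Fin 3 → A
tri x y z 0F = x
tri x y z 1F = y
tri x y z 2F = z

ExactlyOne-resp : {b b′ : A → Bool} → (∀ h → b h ≡ b′ h) → ExactlyOne b → ExactlyOne b′
ExactlyOne-resp eq (h , bh , uniq) = h , trans (sym (eq h)) bh , λ h′ b′h′ → uniq h′ (trans (eq h′) b′h′)

one-0 : ∀ {b : Fin 3 → Bool} → b 0F ≡ true → b 1F ≡ false → b 2F ≡ false → ExactlyOne b
one-0 p q r = 0F , p , λ { 0F _ → refl ; 1F q′ → contradiction (trans (sym q) q′) λ ()
                                       ; 2F r′ → contradiction (trans (sym r) r′) λ () }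

one-1 : ∀ {b : Fin 3 → Bool} → b 0F ≡ false → b 1F ≡ true → b 2F ≡ false → ExactlyOne b
one-1 p q r = 1F , q , λ { 1F _ → refl ; 0F p′ → contradiction (trans (sym p) p′) λ ()
                                       ; 2F r′ → contradiction (trans (sym r) r′) λ () }

one-2 : ∀ {b : Fin 3 → Bool} → b 0F ≡ false → b 1F ≡ false → b 2F ≡ true → ExactlyOne b
one-2 p q r = 2F , r , λ { 2F _ → refl ; 0F p′ → contradiction (trans (sym p) p′) λ ()
                                       ; 1F q′ → contradiction (trans (sym q) q′) λ () }

-- These are the values of the three sets at the first point of a block, where the first set has
-- letter `s` and the second has letter `t`.
exactlyOne-first : ∀ s t → ExactlyOne (tri s (not t) false) → s ≡ t
exactlyOne-first true  true  _ = refl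
exactlyOne-first false false _ = refl
exactlyOne-first true  false (h , _ , uniq) = contradiction (trans (uniq 0F refl) (sym (uniq 1F refl))) λ ()
exactlyOne-first false true  (0F , () , _)
exactlyOne-first false true  (1F , () , _)
exactlyOne-first false true  (2F , () , _)

exactlyOne-last : ∀ t u → ExactlyOne (tri false t (not u)) → t ≡ u
exactlyOne-last true  true  _ = refl
exactlyOne-last false false _ = refl
exactlyOne-last true  false (h , _ , uniq) = contradiction (trans (uniq 1F refl) (sym (uniq 2F refl))) λ ()
exactlyOne-last false true  (0F , () , _)
exactlyOne-last false true  (1F , () , _)
exactlyOne-last false true  (2F , () , _)

module _ {e : ℕ} where

  -- The `e` points after the blocks always go to the first set; this accommodates both parities of
  -- the ground set.
  blocks : ∀ {k} → Fin 3 → Vec Bool k → Vec Bool (k * 2 + e)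
  blocks 0F []      = replicate e true
  blocks 1F []      = replicate e false
  blocks 2F []      = replicate e false
  blocks 0F (b ∷ w) = b     ∷ false ∷ blocks 0F w
  blocks 1F (b ∷ w) = not b ∷ b     ∷ blocks 1F w
  blocks 2F (b ∷ w) = false ∷ not b ∷ blocks 2F w

  -- The first two points tell the three positions apart.
  triple : ∀ {k} → Fin 3 → Vec Bool k → Subset (2 + (k * 2 + e))
  triple 0F w = true  ∷ false ∷ blocks 0F w
  triple 1F w = false ∷ true  ∷ blocks 1F w
  triple 2F w = false ∷ false ∷ blocks 2F w

  blocks-partition : ∀ {k} (w : Vec Bool k) x → ExactlyOne (λ h → lookup (blocks h w) x)
  blocks-partition []          x          = one-0 (lookup-replicate x true) (lookup-replicate x false) (lookup-replicate x false)
  blocks-partition (true ∷ w)  0F         = one-0 refl refl refl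
  blocks-partition (false ∷ w) 0F         = one-1 refl refl refl
  blocks-partition (true ∷ w)  1F         = one-1 refl refl refl
  blocks-partition (false ∷ w) 1F         = one-2 refl refl refl
  blocks-partition (b ∷ w) (suc (suc x))  =
    ExactlyOne-resp (λ { 0F → refl ; 1F → refl ; 2F → refl }) (blocks-partition w x)

  triple-partition : ∀ {k} (w : Vec Bool k) x → ExactlyOne (λ h → lookup (triple h w) x)
  triple-partition w 0F = one-0 refl refl refl
  triple-partition w 1F = one-1 refl refl refl
  triple-partition w (suc (suc x)) =
    ExactlyOne-resp (λ { 0F → refl ; 1F → refl ; 2F → refl }) (blocks-partition w x)

  -- In each block the first point forces the letters of `s` and `t` to agree, the second point
  -- those of `t` and `u`.
  blocks-rigid : ∀ {k} (s t u : Vec Bool k) →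
    (∀ x → ExactlyOne (tri (lookup (blocks 0F s) x) (lookup (blocks 1F t) x) (lookup (blocks 2F u) x))) →
    s ≡ t × t ≡ u
  blocks-rigid [] [] [] _ = refl , refl
  blocks-rigid (a ∷ s) (b ∷ t) (c ∷ u) one
    with refl ← exactlyOne-first a b (one 0F)
    with refl ← exactlyOne-last b c (one 1F)
    with refl , refl ← blocks-rigid s t u (λ x → one (suc (suc x))) = refl , refl

  triple-rigid : ∀ {k} (ws : Fin 3 → Vec Bool k) →
    (∀ x → ExactlyOne (λ h → lookup (triple h (ws h)) x)) → ∀ h → ws h ≡ ws 0F
  triple-rigid ws one
    with s≡t , t≡u ← blocks-rigid (ws 0F) (ws 1F) (ws 2F)
           (λ x → ExactlyOne-resp (λ { 0F → refl ; 1F → refl ; 2F → refl }) (one (suc (suc x))))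
    = λ { 0F → refl ; 1F → sym s≡t ; 2F → sym (trans s≡t t≡u) }

  -- A letter 0 puts the second point of its block into the third set. The excluded word 1...1 would
  -- leave that set empty.
  blocks-last-nonempty : ∀ {k} (w : Vec Bool k) → w ≢ replicate k true →
                         ∃ λ x → lookup (blocks 2F w) x ≡ true
  blocks-last-nonempty []          w≢ = contradiction refl w≢
  blocks-last-nonempty (false ∷ w) w≢ = 1F , refl
  blocks-last-nonempty (true ∷ w)  w≢ with x , p ← blocks-last-nonempty w (w≢ ∘ cong (true ∷_)) = suc (suc x) , p

  -- The second point of a block forces the letter of `t` to be 1; the first point then forces the
  -- letter of `s`.
  blocks-complementary : ∀ {k} (s t : Vec Bool k) →
    (∀ x → lookup (blocks 0F s) x ≡ not (lookup (blocks 1F t) x)) →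
    s ≡ replicate k true × t ≡ replicate k true
  blocks-complementary [] [] _ = refl , refl
  blocks-complementary (a ∷ s) (false ∷ t) eq = contradiction (eq 1F) λ ()
  blocks-complementary (a ∷ s) (true ∷ t) eq
    with refl ← eq 0F
    with refl , refl ← blocks-complementary s t (λ x → eq (suc (suc x))) = refl , refl

  -- On the first two points only positions 0 and 1 are complementary, and for these the blocks
  -- would need the excluded word.
  triple-not-complementary : ∀ {k} (s t : Vec Bool k) → s ≢ replicate k true → ∀ h h′ →
    ¬ (∀ x → lookup (triple h s) x ≡ not (lookup (triple h′ t) x))
  triple-not-complementary s t s≢ 0F 0F eq = contradiction (eq 0F) λ ()
  triple-not-complementary s t s≢ 0F 1F eq = s≢ (proj₁ (blocks-complementary s t (λ x → eq (suc (suc x)))))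
  triple-not-complementary s t s≢ 0F 2F eq = contradiction (eq 1F) λ ()
  triple-not-complementary s t s≢ 1F 0F eq = s≢ (proj₂ (blocks-complementary t s
    (λ x → trans (sym (not-involutive _)) (cong not (sym (eq (suc (suc x))))))))
  triple-not-complementary s t s≢ 1F 1F eq = contradiction (eq 0F) λ ()
  triple-not-complementary s t s≢ 1F 2F eq = contradiction (eq 0F) λ ()
  triple-not-complementary s t s≢ 2F 0F eq = contradiction (eq 1F) λ ()
  triple-not-complementary s t s≢ 2F 1F eq = contradiction (eq 0F) λ ()
  triple-not-complementary s t s≢ 2F 2F eq = contradiction (eq 0F) λ ()

-- Bipartitions and the family of triples and pairs

lookup-ext : {u v : Vec A n} → (∀ x → lookup u x ≡ lookup v x) → u ≡ v
lookup-ext {u = u} {v} eq = trans (sym (tabulate∘lookup u)) (trans (tabulate-cong eq) (tabulate∘lookup v))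

-- The side of the bipartition {S, ∁ S} that misses the point 0, with 0 deleted.
side : Subset (suc n) → Subset n
side (b ∷ v) = if b then map not v else v

side-complementary : (S S′ : Subset (suc n)) → (∀ x → lookup S x ≡ not (lookup S′ x)) → side S ≡ side S′
side-complementary (b ∷ v) (true ∷ v′) eq with refl ← eq 0F =
  lookup-ext λ x → trans (eq (suc x)) (sym (lookup-map x not v′))
side-complementary (b ∷ v) (false ∷ v′) eq with refl ← eq 0F =
  lookup-ext λ x → trans (lookup-map x not v) (trans (cong not (eq (suc x))) (not-involutive _))

≢replicate⇒∃ : ∀ b (v : Vec Bool n) → v ≢ replicate n b → ∃ λ x → lookup v x ≡ not b
≢replicate⇒∃ b []      v≢ = contradiction refl v≢
≢replicate⇒∃ b (c ∷ v) v≢ with c Bool.≟ b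
... | no c≢b = 0F , ¬-not c≢b
... | yes refl with x , p ← ≢replicate⇒∃ b v (v≢ ∘ cong (b ∷_)) = suc x , p

module Construction {k e r s : ℕ}
  (w : Fin r → Vec Bool k) (w-injective : Injective _≡_ _≡_ w) (w≢ : ∀ a → w a ≢ replicate k true)
  (q : Fin s → Subset (suc (k * 2 + e))) (q-injective : Injective _≡_ _≡_ q)
  (q≢∅ : ∀ p → q p ≢ replicate _ false)
  (q≢side : ∀ p a h → q p ≢ side (triple h (w a))) where

  private
    M : ℕ
    M = 2 + (k * 2 + e)

  Index Class : Set
  Index = (Fin r × Fin 3) ⊎ (Fin s × Fin 2)
  Class = Fin r ⊎ Fin s

  infix 4 _≟ᴵ_
  _≟ᴵ_ : DecidableEquality Index
  _≟ᴵ_ = Sum.≡-dec (Product.≡-dec _≟_ _≟_) (Product.≡-dec _≟_ _≟_)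

  pairSet : Fin s → Fin 2 → Subset M
  pairSet p 0F = false ∷ q p
  pairSet p 1F = true ∷ map not (q p)

  F : Index → Subset M
  F (inj₁ (a , h)) = triple h (w a)
  F (inj₂ (p , b)) = pairSet p b

  side-pairSet : ∀ p b → side (pairSet p b) ≡ q p
  side-pairSet p 0F = refl
  side-pairSet p 1F = lookup-ext λ x → trans (lookup-map x not (map not (q p)))
    (trans (cong not (lookup-map x not (q p))) (not-involutive _))

  nonempty : ∀ j → ∃ λ x → lookup (F j) x ≡ true
  nonempty (inj₁ (a , 0F)) = 0F , refl
  nonempty (inj₁ (a , 1F)) = 1F , refl
  nonempty (inj₁ (a , 2F)) with x , p ← blocks-last-nonempty {e} (w a) (w≢ a) = suc (suc x) , p
  nonempty (inj₂ (p , 0F)) with x , p′ ← ≢replicate⇒∃ false (q p) (q≢∅ p) = suc x , p′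
  nonempty (inj₂ (p , 1F)) = 0F , refl

  nonfull : ∀ j → ∃ λ x → lookup (F j) x ≡ false
  nonfull (inj₁ (a , 0F)) = 1F , refl
  nonfull (inj₁ (a , 1F)) = 0F , refl
  nonfull (inj₁ (a , 2F)) = 0F , refl
  nonfull (inj₂ (p , 0F)) = 0F , refl
  nonfull (inj₂ (p , 1F)) with x , p′ ← ≢replicate⇒∃ false (q p) (q≢∅ p) =
    suc x , trans (lookup-map x not (q p)) (cong not p′)

  -- Complementary sets have the same side. The sides `q` are distinct and differ from those of
  -- triples, so only the two sets of one pair remain.
  complementary : ∀ j j′ → (∀ x → lookup (F j) x ≡ not (lookup (F j′) x)) →
    ∃ λ p → (j ≡ inj₂ (p , 0F) × j′ ≡ inj₂ (p , 1F)) ⊎ (j ≡ inj₂ (p , 1F) × j′ ≡ inj₂ (p , 0F))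
  complementary (inj₁ (a , h)) (inj₁ (a′ , h′)) eq =
    contradiction eq (triple-not-complementary (w a) (w a′) (w≢ a) h h′)
  complementary (inj₁ (a , h)) (inj₂ (p , b)) eq = contradiction
    (trans (sym (side-pairSet p b)) (sym (side-complementary (triple h (w a)) (pairSet p b) eq))) (q≢side p a h)
  complementary (inj₂ (p , b)) (inj₁ (a , h)) eq = contradiction
    (trans (sym (side-pairSet p b)) (side-complementary (pairSet p b) (triple h (w a)) eq)) (q≢side p a h)
  complementary (inj₂ (p , b)) (inj₂ (p′ , b′)) eq
    with refl ← q-injective (trans (sym (side-pairSet p b))
                  (trans (side-complementary (pairSet p b) (pairSet p′ b′) eq) (side-pairSet p′ b′)))
    = p , sides b b′ (eq 0F)
    where
    sides : ∀ b b′ → lookup (pairSet p b) 0F ≡ not (lookup (pairSet p b′) 0F) →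
      (inj₂ (p , b) ≡ inj₂ (p , 0F) × inj₂ (p , b′) ≡ inj₂ (p , 1F)) ⊎
      (inj₂ (p , b) ≡ inj₂ (p , 1F) × inj₂ (p , b′) ≡ inj₂ {A = Fin r × Fin 3} (p , 0F))
    sides 0F 0F ()
    sides 1F 1F ()
    sides 0F 1F _ = inj₁ (refl , refl)
    sides 1F 0F _ = inj₂ (refl , refl)

  pairIndex : Bool → Fin 2
  pairIndex true  = 0F
  pairIndex false = 1F

  pairIndex-covers : ∀ p x → lookup (pairSet p (pairIndex (lookup (pairSet p 0F) x))) x ≡ true
  pairIndex-covers p 0F = refl
  pairIndex-covers p (suc x) with lookup (q p) x in eq
  ... | true  = eq
  ... | false = trans (lookup-map x not (q p)) (cong not eq)

  pairIndex-unique : ∀ p b x → lookup (pairSet p b) x ≡ true → pairIndex (lookup (pairSet p 0F) x) ≡ b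
  pairIndex-unique p 0F x eq = cong pairIndex eq
  pairIndex-unique p 1F 0F eq = refl
  pairIndex-unique p 1F (suc x) eq = cong pairIndex
    (trans (sym (not-involutive _)) (cong not (trans (sym (lookup-map x not (q p))) eq)))

  canonical : Resolution F Class
  canonical .class (inj₁ (a , _)) = inj₁ a
  canonical .class (inj₂ (p , _)) = inj₂ p
  canonical .member (inj₁ a) x = inj₁ (a , proj₁ (triple-partition {e} (w a) x))
  canonical .member (inj₂ p) x = inj₂ (p , pairIndex (lookup (pairSet p 0F) x))
  canonical .class-member (inj₁ a) x = refl
  canonical .class-member (inj₂ p) x = refl
  canonical .covers (inj₁ a) x = proj₁ (proj₂ (triple-partition (w a) x))
  canonical .covers (inj₂ p) x = pairIndex-covers p x
  canonical .unique (inj₁ (a , h)) x x∈ = cong (λ h → inj₁ (a , h))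
    (sym (proj₂ (proj₂ (triple-partition (w a) x)) h x∈))
  canonical .unique (inj₂ (p , b)) x x∈ = cong (λ b → inj₂ (p , b)) (pairIndex-unique p b x x∈)

  -- Weighing the classes of an arbitrary resolution

  module Uniqueness (R : Resolution F Class) where

    incidence : ∀ {i} j x → class R j ≡ i → lookup (F j) x ≡ does (member R i x ≟ᴵ j)
    incidence {i} j x refl with member R i x ≟ᴵ j
    ... | yes eq = member⇒∈ R eq
    ... | no neq = ¬-not (neq ∘ unique R j x)

    -- Evidence that a class weighs at least 6. Three members are recorded by points, the first
    -- being 0 and the second 1 unless one member contains both; these points later reveal positions
    -- in triples.
    data Pick (i : Class) : Set where
      pair  : ∀ p → (∀ b → class R (inj₂ (p , b)) ≡ i) → Pick i
      three : (pts : Fin 3 → Fin M) → Injective _≡_ _≡_ (member R i ∘ pts) → pts 0F ≡ 0F →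
              (member R i 1F ≡ member R i 0F ⊎ pts 1F ≡ 1F) → Pick i

    another : ∀ i → ∃ λ x → member R i x ≢ member R i 0F × (member R i 1F ≡ member R i 0F ⊎ x ≡ 1F)
    another i with member R i 1F ≟ᴵ member R i 0F
    ... | no neq = 1F , neq , inj₂ refl
    ... | yes eq with x , x∉ ← nonfull (member R i 0F) =
      x , (λ eq′ → contradiction (trans (sym (member⇒∈ R eq′)) x∉) λ ()) , inj₁ eq

    -- No member is full, so there are at least two. If there is no third, the two are complementary
    -- and hence form a pair.
    pick : ∀ i → Pick i
    pick i with y , y≢ , second ← another i
           with any? (λ z → ¬? (member R i z ≟ᴵ member R i 0F) ×-dec ¬? (member R i z ≟ᴵ member R i y))
    ... | yes (z , z≢0 , z≢y) = three (tri 0F y z) inj refl second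
      where
      inj : Injective _≡_ _≡_ (member R i ∘ tri 0F y z)
      inj {0F} {0F} _  = refl
      inj {0F} {1F} eq = contradiction (sym eq) y≢
      inj {0F} {2F} eq = contradiction (sym eq) z≢0
      inj {1F} {0F} eq = contradiction eq y≢
      inj {1F} {1F} _  = refl
      inj {1F} {2F} eq = contradiction (sym eq) z≢y
      inj {2F} {0F} eq = contradiction eq z≢0
      inj {2F} {1F} eq = contradiction eq z≢y
      inj {2F} {2F} _  = refl
    ... | no ¬z = found (complementary j₀ j₁ compl)
      where
      j₀ = member R i 0F
      j₁ = member R i y
      compl : ∀ x → lookup (F j₀) x ≡ not (lookup (F j₁) x)
      compl x rewrite incidence j₀ x (class-member R i 0F) | incidence j₁ x (class-member R i y)
        with member R i x ≟ᴵ j₀ | member R i x ≟ᴵ j₁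
      ... | yes p | yes p′ = contradiction (trans (sym p′) p) y≢
      ... | yes _ | no _   = refl
      ... | no _  | yes _  = refl
      ... | no ¬p | no ¬p′ = contradiction (x , ¬p , ¬p′) ¬z
      found : _ → Pick i
      found (p , inj₁ (eq₀ , eq₁)) = pair p λ
        { 0F → trans (cong (class R) (sym eq₀)) (class-member R i 0F)
        ; 1F → trans (cong (class R) (sym eq₁)) (class-member R i y) }
      found (p , inj₂ (eq₀ , eq₁)) = pair p λ
        { 1F → trans (cong (class R) (sym eq₀)) (class-member R i 0F)
        ; 0F → trans (cong (class R) (sym eq₁)) (class-member R i y) }

    -- Weights as a finite set: two units for each set of a triple, three for each set of a pair.
    Unit : Set
    Unit = ((Fin r × Fin 3) × Fin 2) ⊎ ((Fin s × Fin 2) × Fin 3)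

    owner : Unit → Index
    owner (inj₁ (j , _)) = inj₁ j
    owner (inj₂ (j , _)) = inj₂ j

    -- Two units that every set has. The third unit of a pair set stays out of reach, and this is
    -- what later detects pairs.
    unit : Index → Fin 2 → Unit
    unit (inj₁ j) b = inj₁ (j , b)
    unit (inj₂ j) b = inj₂ (j , inject₁ b)

    owner-unit : ∀ j b → owner (unit j b) ≡ j
    owner-unit (inj₁ _) b = refl
    owner-unit (inj₂ _) b = refl

    unit-injective : ∀ {j j′ b b′} → unit j b ≡ unit j′ b′ → j ≡ j′ × b ≡ b′
    unit-injective {inj₁ _} {inj₁ _} refl = refl , refl
    unit-injective {inj₂ _} {inj₂ _} eq with refl ← ,-injectiveˡ (inj₂-injective eq) =
      refl , inject₁-injective (,-injectiveʳ (inj₂-injective eq))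

    unit≢third : ∀ {j b j′} → unit j b ≢ inj₂ (j′ , fromℕ 2)
    unit≢third {inj₂ _} eq = fromℕ≢inject₁ (sym (,-injectiveʳ (inj₂-injective eq)))

    units : ∀ {i} → Pick i → Fin 3 × Fin 2 → Unit
    units {i} (pair p _)        (h , b) = inj₂ ((p , b) , h)
    units {i} (three pts _ _ _) (h , b) = unit (member R i (pts h)) b

    units-injective : ∀ {i} (P : Pick i) → Injective _≡_ _≡_ (units P)
    units-injective (pair p _) refl = refl
    units-injective (three pts inj _ _) {h , b} {h′ , b′} eq with eq₁ , refl ← unit-injective eq
      with refl ← inj {h} {h′} eq₁ = refl

    class-owner-units : ∀ {i} (P : Pick i) u → class R (owner (units P u)) ≡ i
    class-owner-units (pair p cls) (h , b) = cls b
    class-owner-units {i} (three pts _ _ _) (h , b) = trans (cong (class R) (owner-unit _ b)) (class-member R i (pts h))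

    allUnits : Class × (Fin 3 × Fin 2) → Unit
    allUnits (i , u) = units (pick i) u

    allUnits-injective : Injective _≡_ _≡_ allUnits
    allUnits-injective {i , u} {i′ , u′} eq
      with refl ← trans (sym (class-owner-units (pick i) u))
                    (trans (cong (class R ∘ owner) eq) (class-owner-units (pick i′) u′))
      with refl ← units-injective (pick i) eq = refl

    Exhausts : ∀ {i} → Pick i → Set
    Exhausts {i} P = ∀ v → class R (owner v) ≡ i → ∃ λ u → units P u ≡ v

    Class×6↔ : Fin ((r + s) * (3 * 2)) ↔ (Class × (Fin 3 × Fin 2))
    Class×6↔ = ↔-trans *↔× (+↔⊎ ×-↔ *↔×)

    Unit↔ : Fin (r * 3 * 2 + s * 2 * 3) ↔ Unit
    Unit↔ = ↔-trans +↔⊎ (↔-trans *↔× (*↔× ×-↔ ↔-refl) ⊎-↔ ↔-trans *↔× (*↔× ×-↔ ↔-refl))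

    weights : r * 3 * 2 + s * 2 * 3 ≡ (r + s) * (3 * 2)
    weights = solve 2 (λ r s → r :* con 3 :* con 2 :+ s :* con 2 :* con 3
                            := (r :+ s) :* (con 3 :* con 2)) refl r s

    allUnits-surjective : ∀ v → ∃ λ u → allUnits u ≡ v
    allUnits-surjective = ↔-injective⇒surjective Class×6↔ (subst (λ c → Fin c ↔ Unit) weights Unit↔)
                            allUnits allUnits-injective

    -- The six units found in each class already amount to the total weight, so the injection
    -- `allUnits` is onto and no class has a unit to spare.
    pick-exhausts : ∀ i → Exhausts (pick i)
    pick-exhausts i v refl = from-surjective (allUnits-surjective v)
      where
      from-surjective : (∃ λ u → allUnits u ≡ v) → ∃ λ u → units (pick (class R (owner v))) u ≡ v
      from-surjective ((i′ , u) , eq) with refl ← trans (sym (class-owner-units (pick i′) u)) (cong (class R ∘ owner) eq) = u , eq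

    -- The third unit of a pair set is reached only in the case `pair`.
    pair-together : ∀ {i} (P : Pick i) → Exhausts P → ∀ {p b} → class R (inj₂ (p , b)) ≡ i →
                    ∀ b′ → class R (inj₂ (p , b′)) ≡ i
    pair-together P exh {p} {b} cls with exh (inj₂ ((p , b) , fromℕ 2)) cls
    pair-together (pair p cls) exh _ | _ , refl = cls
    pair-together (three _ _ _ _) exh _ | u , eq = contradiction eq unit≢third

    -- Exhaustion leaves exactly three members, all from triples. The first two points give them the
    -- positions 0, 1 and 2, and rigidity gives them one common word.
    triple-together : ∀ {i} (P : Pick i) → Exhausts P → ∀ {a h} → class R (inj₁ (a , h)) ≡ i →
                      ∀ h′ → class R (inj₁ (a , h′)) ≡ i
    triple-together (pair _ _) exh {a} {h} cls with () ← proj₂ (exh (inj₁ ((a , h) , 0F)) cls)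
    triple-together {i} (three pts inj start second) exh {a} {h} cls h′ =
      trans (cong (class R) (trans (cong (λ a → inj₁ (a , h′)) a≡) (sym (proj₂ (shape h′)))))
            (class-member R i (pts h′))
      where
      triples-only : ∀ j → class R j ≡ i → ∃ λ q → j ≡ inj₁ q
      triples-only (inj₁ q) _ = q , refl
      triples-only (inj₂ q) c = contradiction (proj₂ (exh (inj₂ (q , fromℕ 2)) c)) unit≢third

      listed : ∀ j → class R j ≡ i → ∃ λ h → member R i (pts h) ≡ j
      listed j c with (h , b) , eq ← exh (unit j 0F) (trans (cong (class R) (owner-unit j 0F)) c) =
        h , proj₁ (unit-injective eq)

      first-position : ∀ {j a h} → j ≡ inj₁ (a , h) → lookup (F j) 0F ≡ true → h ≡ 0F
      first-position {h = 0F} refl _ = refl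
      first-position {h = 1F} refl ()
      first-position {h = 2F} refl ()

      second-position : ∀ {j a h} → j ≡ inj₁ (a , h) → lookup (F j) 1F ≡ true → h ≡ 1F
      second-position {h = 1F} refl _ = refl
      second-position {h = 0F} refl ()
      second-position {h = 2F} refl ()

      at-0 : ∃ λ a → member R i 0F ≡ inj₁ (a , 0F)
      at-0 with (a , h) , eq ← triples-only _ (class-member R i 0F)
        with refl ← first-position eq (covers R i 0F) = a , eq

      at-1 : ∃ λ a → member R i 1F ≡ inj₁ (a , 1F)
      at-1 with (a , h) , eq ← triples-only _ (class-member R i 1F)
        with refl ← second-position eq (covers R i 1F) = a , eq

      -- The members at the points 0 and 1 have different positions, so they differ.
      pts-1 : pts 1F ≡ 1F
      pts-1 = [ (λ eq → contradiction (trans (sym (proj₂ at-1)) (trans eq (proj₂ at-0))) λ ()) , id ]′ second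

      ∈⇒member : ∀ {h} x → lookup (F (member R i (pts h))) x ≡ true → member R i x ≡ member R i (pts h)
      ∈⇒member {h} x p = trans (cong (λ i → member R i x) (sym (class-member R i (pts h)))) (unique R _ x p)

      shape : ∀ h → ∃ λ a → member R i (pts h) ≡ inj₁ (a , h)
      shape 0F rewrite start = at-0
      shape 1F rewrite pts-1 = at-1
      shape 2F with triples-only _ (class-member R i (pts 2F))
      ... | (a , 2F) , eq = a , eq
      -- In position 0 or 1 the third member would contain the point 0 or 1 and so coincide with one
      -- of the first two.
      ... | (a , 0F) , eq = contradiction (inj {0F} {2F} (trans (cong (member R i) start)
              (∈⇒member 0F (subst (λ j → lookup (F j) 0F ≡ true) (sym eq) refl)))) λ ()
      ... | (a , 1F) , eq = contradiction (inj {1F} {2F} (trans (cong (member R i) pts-1)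
              (∈⇒member 1F (subst (λ j → lookup (F j) 1F ≡ true) (sym eq) refl)))) λ ()

      partition : ∀ x → ExactlyOne (λ h → lookup (triple h (w (proj₁ (shape h)))) x)
      partition x = ExactlyOne-resp (λ h → cong (λ j → lookup (F j) x) (proj₂ (shape h)))
        ( proj₁ lx , member⇒∈ R (sym (proj₂ lx))
        , λ h p → inj (trans (sym (∈⇒member x p)) (sym (proj₂ lx))))
        where
        lx = listed (member R i x) (class-member R i x)

      same-code : ∀ h → proj₁ (shape h) ≡ proj₁ (shape 0F)
      same-code h = w-injective (triple-rigid (λ h → w (proj₁ (shape h))) partition h)

      a≡ : a ≡ proj₁ (shape h′)
      a≡ with h″ , eq ← listed (inj₁ (a , h)) cls =
        trans (,-injectiveˡ (inj₁-injective (trans (sym eq) (proj₂ (shape h″)))))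
              (trans (same-code h″) (sym (same-code h′)))

    canonical-refines : canonical Refines R
    canonical-refines (inj₁ (a , h)) (inj₁ (.a , h′)) refl = sym (triple-together (pick _) (pick-exhausts _) refl h′)
    canonical-refines (inj₂ (p , b)) (inj₂ (.p , b′)) refl = sym (pair-together (pick _) (pick-exhausts _) refl b′)

  uniquely-resolvable : Σ (Fin (r * 3 + s * 2) → Subset M) (UniquelyResolvable (r + s))
  uniquely-resolvable = _ , uniquelyResolvable (↔-trans +↔⊎ (*↔× ⊎-↔ *↔×)) +↔⊎ canonical nonempty
    (λ R → Uniqueness.canonical-refines R)

-- Choice of the parameters and conclusion

construct : ∀ k e r s → 1 + r ≤ 2 ^ k → 1 + r * 3 + s ≤ 2 ^ suc (k * 2 + e) →
            Σ (Fin (r * 3 + s * 2) → Subset (2 + (k * 2 + e))) (UniquelyResolvable (r + s))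
construct k e r s r<2^k fits = uniquely-resolvable
  where
  -- The one forbidden word is 1...1.
  codes = avoiding-injection r r<2^k (λ (_ : Fin 1) → Inverse.from (bits k) (replicate k true))
  w : Fin r → Vec Bool k
  w = Inverse.to (bits k) ∘ proj₁ codes
  w≢ : ∀ a → w a ≢ replicate k true
  w≢ a eq = proj₂ (proj₂ codes) 0F a
    (trans (cong (Inverse.from (bits k)) (sym eq)) (Inverse.strictlyInverseʳ (bits k) _))
  used : ⊤ ⊎ (Fin r × Fin 3) → Subset (suc (k * 2 + e))
  used (inj₁ _)       = replicate _ false
  used (inj₂ (a , h)) = side (triple h (w a))
  index : Fin (1 + r * 3) ↔ (⊤ ⊎ (Fin r × Fin 3))
  index = ↔-trans +↔⊎ (1↔⊤ ⊎-↔ *↔×)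
  -- Forbidden are the empty set and three sides for each triple, at most `1 + r * 3` subsets.
  sides = avoiding-injection s fits (Inverse.from (bits (suc (k * 2 + e))) ∘ used ∘ Inverse.to index)
  q : Fin s → Subset (suc (k * 2 + e))
  q = Inverse.to (bits (suc (k * 2 + e))) ∘ proj₁ sides
  q≢used : ∀ p u → q p ≢ used u
  q≢used p u eq = proj₂ (proj₂ sides) (Inverse.from index u) p
    (trans (cong (Inverse.from (bits _) ∘ used) (Inverse.strictlyInverseˡ index u))
      (trans (cong (Inverse.from (bits _)) (sym eq)) (Inverse.strictlyInverseʳ (bits (suc (k * 2 + e))) _)))
  open Construction w (proj₁ (proj₂ codes) ∘ to-injective (bits k)) w≢
    q (proj₁ (proj₂ sides) ∘ to-injective (bits (suc (k * 2 + e))))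
    (λ p → q≢used p (inj₁ tt)) (λ p a h → q≢used p (inj₂ (a , h)))

upper-bound : ∀ {m n} t (F : Fin t → Subset (suc m)) → UniquelyResolvable n F → 1 + t * 2 ≤ 2 ^ m + n * 3
upper-bound t F (nonempty , (c , r) , coincide) with R , refl ← fromIsResolution r =
  UpperBound.bound R nonempty (λ c′ → coincide (class R) c′ r)

maximum : ∀ k e n → 1 ≤ k →
  2 ^ suc (k * 2 + e) + 1 ∸ 2 ^ suc k ≤ n → n ≤ 2 ^ suc (k * 2 + e) ∸ 1 →
  IsMaxURSize n (2 + (k * 2 + e)) (2 * n + (2 ^ suc (k * 2 + e) ∸ 1 ∸ n) / 2)
maximum k e n 1≤k lo hi =
  subst₂ (λ n v → Σ (Fin v → Subset (2 + (k * 2 + e))) (UniquelyResolvable n)) r+s≡n size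
    (construct k e r s r<Y fits) , largest
  where
  X = 2 ^ suc (k * 2 + e)
  Y = 2 ^ k
  d = X ∸ 1 ∸ n
  r = d / 2
  s = n ∸ r

  X≡ : X ≡ 1 + n + (d % 2 + r * 2)
  X≡ = begin
    X                        ≡⟨ ℕ.m+[n∸m]≡n (ℕ.m^n>0 2 (suc (k * 2 + e))) ⟨
    1 + (X ∸ 1)              ≡⟨ cong suc (ℕ.m+[n∸m]≡n hi) ⟨
    1 + n + d                ≡⟨ cong (1 + n +_) (m≡m%n+[m/n]*n d 2) ⟩
    1 + n + (d % 2 + r * 2)  ∎
    where open ≡-Reasoning

  lo′ : X + 1 ≤ 2 * Y + n
  lo′ = ℕ.≤-trans (ℕ.m≤n+m∸n (X + 1) (2 * Y)) (ℕ.+-monoʳ-≤ (2 * Y) lo)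

  -- Here the lower limit on `n` enters: it leaves enough words for `r` triples.
  r<Y : 1 + r ≤ Y
  r<Y = ℕ.*-cancelˡ-≤ 2 (ℕ.+-cancelʳ-≤ n _ _ (begin
    2 * (1 + r) + n              ≡⟨ solve 2 (λ r n → con 2 :* (con 1 :+ r) :+ n := con 1 :+ n :+ r :* con 2 :+ con 1) refl r n ⟩
    1 + n + r * 2 + 1            ≤⟨ ℕ.+-monoˡ-≤ 1 (ℕ.+-monoʳ-≤ (1 + n) (ℕ.m≤n+m (r * 2) (d % 2))) ⟩
    1 + n + (d % 2 + r * 2) + 1  ≡⟨ cong (_+ 1) X≡ ⟨
    X + 1                        ≤⟨ lo′ ⟩
    2 * Y + n                    ∎))
    where open ℕ.≤-Reasoning

  -- Makes `n ∸ r` a true difference. Since `k` is at least 1, `X` is at least four times `Y`.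
  Y≤n : Y ≤ n
  Y≤n = ℕ.+-cancelˡ-≤ (2 * Y) _ _ (begin
    2 * Y + Y                                      ≤⟨ ℕ.+-monoʳ-≤ (2 * Y) (ℕ.m≤m+n Y (Y + 0)) ⟩
    2 * Y + 2 * Y                                  ≤⟨ ℕ.+-mono-≤ 2Y≤ 2Y≤ ⟩
    2 ^ (k * 2 + e) + 2 ^ (k * 2 + e)              ≡⟨ cong (2 ^ (k * 2 + e) +_) (ℕ.+-identityʳ _) ⟨
    X                                              ≤⟨ ℕ.m≤m+n X 1 ⟩
    X + 1                                          ≤⟨ lo′ ⟩
    2 * Y + n                                      ∎)
    where
    open ℕ.≤-Reasoning
    2Y≤ : 2 ^ suc k ≤ 2 ^ (k * 2 + e)
    2Y≤ = ℕ.^-monoʳ-≤ 2 (begin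
      1 + k      ≤⟨ ℕ.+-monoˡ-≤ k 1≤k ⟩
      k + k      ≡⟨ solve 1 (λ k → k :+ k := k :* con 2) refl k ⟩
      k * 2      ≤⟨ ℕ.m≤m+n _ e ⟩
      k * 2 + e  ∎)

  r+s≡n : r + s ≡ n
  r+s≡n = ℕ.m+[n∸m]≡n (ℕ.≤-trans (ℕ.<⇒≤ r<Y) Y≤n)

  fits : 1 + r * 3 + s ≤ X
  fits = begin
    1 + r * 3 + s            ≡⟨ solve 2 (λ r s → con 1 :+ r :* con 3 :+ s := con 1 :+ (r :+ s) :+ r :* con 2) refl r s ⟩
    1 + (r + s) + r * 2      ≡⟨ cong (λ z → 1 + z + r * 2) r+s≡n ⟩
    1 + n + r * 2            ≤⟨ ℕ.+-monoʳ-≤ (1 + n) (ℕ.m≤n+m (r * 2) (d % 2)) ⟩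
    1 + n + (d % 2 + r * 2)  ≡⟨ X≡ ⟨
    X                        ∎
    where open ℕ.≤-Reasoning

  size : r * 3 + s * 2 ≡ 2 * n + r
  size = trans (solve 2 (λ r s → r :* con 3 :+ s :* con 2 := con 2 :* (r :+ s) :+ r) refl r s)
               (cong (λ z → 2 * z + r) r+s≡n)

  largest : ∀ t (F : Fin t → Subset (2 + (k * 2 + e))) → UniquelyResolvable n F → t ≤ 2 * n + r
  largest t F UR = ℕ.≤-pred (ℕ.*-cancelʳ-< 2 t (suc (2 * n + r)) (begin
    1 + t * 2                              ≤⟨ upper-bound t F UR ⟩
    X + n * 3                              ≡⟨ cong (_+ n * 3) X≡ ⟩
    1 + n + (d % 2 + r * 2) + n * 3        ≡⟨ solve 3 (λ n p r → con 1 :+ n :+ (p :+ r :* con 2) :+ n :* con 3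
                                                := (con 1 :+ p) :+ (con 2 :* n :+ r) :* con 2) refl n (d % 2) r ⟩
    -- The remainder modulo 2 is at most 1, which leaves no room for a further member.
    (1 + d % 2) + (2 * n + r) * 2          ≤⟨ ℕ.+-monoˡ-≤ _ (m%n<n d 2) ⟩
    suc (2 * n + r) * 2                    ∎))
    where open ℕ.≤-Reasoning

-- Two points serve as markers and the others form blocks, with one point left over when `m` is odd;
-- `4 ≤ m` leaves at least one block.
halves : ∀ m → 4 ≤ m → ∃ λ k → 1 ≤ k × m / 2 ≡ suc k × m ≡ 2 + (k * 2 + m % 2)
halves m 4≤m with m / 2 in eq | m≡m%n+[m/n]*n m 2 | /-monoˡ-≤ 2 4≤m
... | suc k | m≡ | s≤s 1≤k = k , 1≤k , refl , trans m≡ (ℕ.+-comm (m % 2) _)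

theorem29 : (m n : ℕ) → 4 ≤ m →
    2 ^ (m ∸ 1) + 1 ∸ 2 ^ (m / 2) ≤ n → n ≤ 2 ^ (m ∸ 1) ∸ 1 →
    IsMaxURSize n m (2 * n + (2 ^ (m ∸ 1) ∸ 1 ∸ n) / 2)
theorem29 m n 4≤m with k , 1≤k , m/2≡ , m≡ ← halves m 4≤m rewrite m/2≡ = at m≡
  where
  -- The remainder `m % 2` is generalised to `e`, since otherwise `m` occurs on both sides of the
  -- equation and `refl` cannot be matched.
  at : ∀ {m e} → m ≡ 2 + (k * 2 + e) → 2 ^ (m ∸ 1) + 1 ∸ 2 ^ suc k ≤ n → n ≤ 2 ^ (m ∸ 1) ∸ 1 →
       IsMaxURSize n m (2 * n + (2 ^ (m ∸ 1) ∸ 1 ∸ n) / 2)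
  at {e = e} refl = maximum k e n 1≤k
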